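{- For every finite simple graph $G$ and every integer $n\ge 2$, $$\chi_i(S_G^2)\le \chi_i(S_G^n)\le \chi_i(S_G^2)+1.$$
   Context: For a graph $H$, an injective $k$-coloring is a map $f:V(H)\to\{1,\dots,k\}$ such that any two distinct vertices $u,w$ with $f(u)=f(w)$ have no common neighbor. The injective chromatic number $\chi_i(H)$ is the least $k$ for which $H$ admits an injective $k$-coloring. For a graph $G$ and a positive integer $n$, the generalized Sierpiński graph $S_G^n$ has vertex set $V(G)^n$, and two vertices $(u_1,\dots,u_n)$, $(v_1,\dots,v_n)$ are adjacent if and only if there is $d\in\{1,\dots,n\}$ such that $u_i=v_i$ for all $i<d$, $u_dv_d\in E(G)$, and $u_i=v_d$ and $v_i=u_d$ for all $i>d$. (In particular $S_G^1\cong G$.) -}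

module Defs where

open import Data.Nat using (ℕ; zero; suc; _≤_; z≤n; s≤s; _^_)
open import Data.Fin using (Fin; zero; _<_)
open import Data.Fin.Properties using (any?; all?; _≟_; _<?_; *↔×)
open import Data.Vec using (Vec; []; _∷_; lookup; tabulate)
open import Data.Vec.Properties using (lookup∘tabulate)
open import Data.Product using (∃; _×_; _,_; proj₁; proj₂)
open import Data.Product.Function.NonDependent.Propositional using (_×-↔_)
open import Function using (_∘_)
open import Function.Bundles using (_↔_; mk↔ₛ′; Inverse)
open import Function.Construct.Composition using (_↔-∘_)
open import Function.Construct.Identity using (↔-id)
open import Function.Construct.Symmetry using (↔-sym)
open import Function.Properties.Inverse using (↔⇒↣)
open import Relation.Binary.Definitions using (Decidable; Symmetric; Irreflexive; DecidableEquality)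
open import Relation.Binary.PropositionalEquality using (_≡_; _≢_; refl; sym; trans; cong; subst)
open import Relation.Nullary using (Dec; yes; no; ¬_; contradiction)
open import Relation.Nullary.Decidable using (map′; via-injection; _×-dec_; _→-dec_; ¬?)
import Relation.Unary as U

-- Adjacency is required to be decidable: classically this is automatic, and it
-- is what makes the chromatic number below an actual natural number.
record FiniteSimpleGraph : Set₁ where
  field
    Vertex     : Set
    order      : ℕ
    enumerate  : Vertex ↔ Fin order
    Adj        : Vertex → Vertex → Set
    adj?       : Decidable Adj
    adj-sym    : Symmetric Adj
    adj-irrefl : Irreflexive _≡_ Adj

  vertex≟ : DecidableEquality Vertex
  vertex≟ = via-injection (↔⇒↣ enumerate) _≟_

module _ {A : Set} {m : ℕ} (fin : A ↔ Fin m) where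

  open Inverse fin

  finite-any? : {P : A → Set} → U.Decidable P → Dec (∃ P)
  finite-any? {P} P? =
    map′ (λ (i , p) → from i , p)
         (λ (a , p) → to a , subst P (sym (strictlyInverseʳ a)) p)
         (any? (P? ∘ from))

  finite-all? : {P : A → Set} → U.Decidable P → Dec (∀ a → P a)
  finite-all? {P} P? =
    map′ (λ h a → subst P (strictlyInverseʳ a) (h (to a)))
         (λ h i → h (from i))
         (all? (P? ∘ from))

  vec-finite : ∀ n → Vec A n ↔ Fin (m ^ n)
  vec-finite zero = mk↔ₛ′ (λ _ → zero) (λ _ → []) (λ { zero → refl }) (λ { [] → refl })
  vec-finite (suc n) = ↔-sym *↔× ↔-∘ ((fin ×-↔ vec-finite n) ↔-∘ uncons)
    where
    uncons : Vec A (suc n) ↔ (A × Vec A n)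
    uncons = mk↔ₛ′ (λ { (x ∷ xs) → x , xs }) (λ (x , xs) → x ∷ xs)
                   (λ _ → refl) (λ { (_ ∷ _) → refl })

module _ (H : FiniteSimpleGraph) where

  open FiniteSimpleGraph H

  CommonNeighbour : Vertex → Vertex → Set
  CommonNeighbour u w = ∃ λ x → Adj u x × Adj w x

  IsInjectiveColoring : {k : ℕ} → (Vertex → Fin k) → Set
  IsInjectiveColoring f = ∀ u w → u ≢ w → f u ≡ f w → ¬ CommonNeighbour u w

  InjectivelyColorable : ℕ → Set
  InjectivelyColorable k = ∃ λ (f : Vertex → Fin k) → IsInjectiveColoring f

  isInjectiveColoring? : ∀ {k} (f : Vertex → Fin k) → Dec (IsInjectiveColoring f)
  isInjectiveColoring? f =
    finite-all? enumerate λ u → finite-all? enumerate λ w →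
      ¬? (vertex≟ u w) →-dec (f u ≟ f w →-dec
        ¬? (finite-any? enumerate λ x → adj? u x ×-dec adj? w x))

  injectivelyColorable? : U.Decidable InjectivelyColorable
  injectivelyColorable? k =
    map′ (λ (c , p) → toFun c , p) (λ (f , p) → tabulate (f ∘ from) , fromFun f p)
         (finite-any? (vec-finite (↔-id (Fin k)) order) (isInjectiveColoring? ∘ toFun))
    where
    open Inverse enumerate
    toFun : Vec (Fin k) order → Vertex → Fin k
    toFun c v = lookup c (to v)
    toFun-tabulate : ∀ f v → toFun (tabulate (f ∘ from)) v ≡ f v
    toFun-tabulate f v =
      trans (lookup∘tabulate (f ∘ from) (to v)) (cong f (strictlyInverseʳ v))
    fromFun : ∀ f → IsInjectiveColoring f → IsInjectiveColoring (toFun (tabulate (f ∘ from)))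
    fromFun f p u w u≢w e =
      p u w u≢w (trans (sym (toFun-tabulate f u)) (trans e (toFun-tabulate f w)))

  injectivelyColorable-order : InjectivelyColorable order
  injectivelyColorable-order = to , λ u w u≢w e _ →
    u≢w (trans (sym (strictlyInverseʳ u)) (trans (cong from e) (strictlyInverseʳ w)))
    where open Inverse enumerate

IsLeast : (ℕ → Set) → ℕ → Set
IsLeast P k = P k × (∀ j → P j → k ≤ j)

least : {P : ℕ → Set} → U.Decidable P → ∀ n → P n → ∃ (IsLeast P)
least P? n pn with P? 0
... | yes p0 = 0 , p0 , λ _ _ → z≤n
least P? zero    pn | no ¬p0 = contradiction pn ¬p0
least P? (suc n) pn | no ¬p0 with least (P? ∘ suc) n pn
... | k , pk , min = suc k , pk ,
  λ { zero p0 → contradiction p0 ¬p0 ; (suc j) pj → s≤s (min j pj) }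

injectiveChromaticNumber : (H : FiniteSimpleGraph) → ∃ (IsLeast (InjectivelyColorable H))
injectiveChromaticNumber H =
  least (injectivelyColorable? H) (FiniteSimpleGraph.order H) (injectivelyColorable-order H)

χᵢ : FiniteSimpleGraph → ℕ
χᵢ H = proj₁ (injectiveChromaticNumber H)

χᵢ-isLeast : ∀ H → IsLeast (InjectivelyColorable H) (χᵢ H)
χᵢ-isLeast H = proj₂ (injectiveChromaticNumber H)

module _ (G : FiniteSimpleGraph) where

  open FiniteSimpleGraph G

  SierpinskiAdj : (n : ℕ) → Vec Vertex n → Vec Vertex n → Set
  SierpinskiAdj n u v = ∃ λ (d : Fin n) →
    (∀ i → i < d → lookup u i ≡ lookup v i) ×
    Adj (lookup u d) (lookup v d) ×
    (∀ i → d < i → lookup u i ≡ lookup v d × lookup v i ≡ lookup u d)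

  -- Meaningful for positive n; for n = 0 this is a single isolated vertex.
  sierpinski : ℕ → FiniteSimpleGraph
  sierpinski n = record
    { Vertex     = Vec Vertex n
    ; order      = order ^ n
    ; enumerate  = vec-finite enumerate n
    ; Adj        = SierpinskiAdj n
    ; adj?       = λ u v → any? λ d →
        (all? λ i → (i <? d) →-dec vertex≟ (lookup u i) (lookup v i)) ×-dec
        adj? (lookup u d) (lookup v d) ×-dec
        (all? λ i → (d <? i) →-dec
          (vertex≟ (lookup u i) (lookup v d) ×-dec vertex≟ (lookup v i) (lookup u d)))
    ; adj-sym    = λ (d , before , at , after) →
        d , (λ i i<d → sym (before i i<d)) , adj-sym at ,
        (λ i d<i → proj₂ (after i d<i) , proj₁ (after i d<i))
    ; adj-irrefl = λ { refl (_ , _ , at , _) → adj-irrefl refl at }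
    }

{-# OPTIONS --safe #-}

-- Lower bound: prefixing a fixed vertex embeds S^n into S^(n+1), and injective
-- colourings restrict along this embedding.
-- Upper bound: an edge of S^n not inside a copy p·S² joins two vertices whose
-- last two letters agree.  Give all vertices ending in a repeated letter one
-- new colour, and colour the others by their last two letters, using an
-- injective colouring of S².  Each vertex has at most one neighbour outside its
-- copy of S², and only if it ends in a repeated letter itself; in that case all
-- its neighbours inside the copy avoid the new colour.

module Submission where

open import Defs
open import Data.Nat using (ℕ; zero; suc; _≤_; _+_; z≤n; s≤s)
open import Data.Nat.Properties using (+-comm)
open import Data.Fin using (Fin; zero; suc)
open import Data.Fin.Properties using (suc-injective)
open import Data.Vec using (Vec; []; _∷_; head; lookup; replicate)
open import Data.Vec.Properties using (∷-injectiveˡ)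
open import Data.Product using (_×_; _,_)
open import Data.Sum using (_⊎_; inj₁; inj₂)
open import Function using (_∘_)
open import Relation.Binary.PropositionalEquality using (_≡_; _≢_; refl; sym; trans; cong; cong₂; subst)
open import Relation.Nullary using (yes; no; contradiction)

lookup-constant⇒replicate : ∀ {A : Set} {n} (xs : Vec A n) {a} →
  (∀ i → lookup xs i ≡ a) → xs ≡ replicate n a
lookup-constant⇒replicate []       h = refl
lookup-constant⇒replicate (x ∷ xs) h =
  cong₂ _∷_ (h zero) (lookup-constant⇒replicate xs (h ∘ suc))

module _ (G : FiniteSimpleGraph) where

  open FiniteSimpleGraph G

  adj-∷ : ∀ {n} c {u v : Vec Vertex n} →
    SierpinskiAdj G n u v → SierpinskiAdj G (suc n) (c ∷ u) (c ∷ v)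
  adj-∷ c (d , before , at , after) =
    suc d ,
    (λ { zero _ → refl ; (suc i) (s≤s i<d) → before i i<d }) ,
    at ,
    (λ { (suc i) (s≤s d<i) → after i d<i })

  -- The differing position `d` either lies in the tail or is the first letter, and then every later
  -- letter is forced. This splits edges into those inside a copy of the smaller graph and the
  -- linking edges between copies; all later case analyses use it.
  adj-∷⁻ : ∀ {n x y} {xs ys : Vec Vertex n} →
    SierpinskiAdj G (suc n) (x ∷ xs) (y ∷ ys) →
    (x ≡ y × SierpinskiAdj G n xs ys) ⊎
    (Adj x y × xs ≡ replicate n y × ys ≡ replicate n x)
  adj-∷⁻ {xs = xs} {ys} (zero , _ , at , after) = inj₂
    ( at
    , lookup-constant⇒replicate xs (λ i → let p , _ = after (suc i) (s≤s z≤n) in p)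
    , lookup-constant⇒replicate ys (λ i → let _ , q = after (suc i) (s≤s z≤n) in q) )
  adj-∷⁻ (suc d , before , at , after) = inj₁
    ( before zero (s≤s z≤n)
    , d , (λ i i<d → before (suc i) (s≤s i<d)) , at , (λ i d<i → after (suc i) (s≤s d<i)) )

  colorable-pred : ∀ {n k} → Vertex →
    InjectivelyColorable (sierpinski G (suc n)) k →
    InjectivelyColorable (sierpinski G n) k
  colorable-pred c (f , inj) =
    f ∘ (c ∷_) ,
    λ { u w u≢w e (x , ux , wx) →
        inj (c ∷ u) (c ∷ w) (λ { refl → u≢w refl }) e (c ∷ x , adj-∷ c ux , adj-∷ c wx) }

  colorable-restrict : ∀ m {n k} →
    InjectivelyColorable (sierpinski G (m + suc n)) k →
    InjectivelyColorable (sierpinski G (suc n)) k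
  -- As `v ≡ v` always holds, the search decides whether `G` has a vertex to serve as prefix letter.
  colorable-restrict m c with finite-any? enumerate (λ v → vertex≟ v v)
  -- With no vertices there are no words of positive length; the empty word would still exist, hence
  -- `suc n`.
  ... | no  empty   = (λ u → contradiction (head u , refl) empty) ,
                      (λ u → contradiction (head u , refl) empty)
  ... | yes (v , _) = drop m c
    where
    drop : ∀ m {n k} → InjectivelyColorable (sierpinski G (m + n)) k →
      InjectivelyColorable (sierpinski G n) k
    drop zero    c = c
    drop (suc m) c = drop m (colorable-pred v c)

  module _ {k} (f : Vec Vertex 2 → Fin k) where

    extend : ∀ {m} → Vec Vertex (2 + m) → Fin (suc k)
    extend {zero} (a ∷ b ∷ []) with vertex≟ a b
    ... | yes _ = zero
    ... | no  _ = suc (f (a ∷ b ∷ []))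
    extend {suc m} (_ ∷ xs) = extend xs

    extend-replicate : ∀ m c → extend (replicate (2 + m) c) ≡ zero
    extend-replicate zero c with vertex≟ c c
    ... | yes _   = refl
    ... | no  c≢c = contradiction refl c≢c
    extend-replicate (suc m) c = extend-replicate m c

    -- If an edge to a constant word changed a letter before the last, the forced later letters
    -- would yield a loop in `G`. So only the last letter changes, and the neighbour's last two
    -- letters differ.
    extend-adj-replicate : ∀ {m c} (u : Vec Vertex (2 + m)) →
      SierpinskiAdj G (2 + m) u (replicate (2 + m) c) → extend u ≢ zero
    extend-adj-replicate (a ∷ us) adj e with adj-∷⁻ adj
    ... | inj₂ (a~c , _ , c≡a) = adj-irrefl (sym (∷-injectiveˡ c≡a)) a~c
    extend-adj-replicate {zero} (a ∷ b ∷ []) adj e | inj₁ (a≡c , tl)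
      with vertex≟ a b | adj-∷⁻ tl
    ... | yes a≡b | inj₂ (b~c , _) = adj-irrefl (trans (sym a≡b) a≡c) b~c
    extend-adj-replicate {suc m} (a ∷ us) adj e | inj₁ (_ , tl) =
      extend-adj-replicate us tl e

    -- Only the new colour needs an argument: a neighbour of `aa` must keep the first letter `a`, so
    -- distinct words `aa` and `cc` share no neighbour.
    extend-injective₂ : IsInjectiveColoring (sierpinski G 2) f →
      IsInjectiveColoring (sierpinski G 2) (extend {0})
    extend-injective₂ inj (a ∷ b ∷ []) (c ∷ d ∷ []) u≢w e (x ∷ y ∷ [] , ux , wx)
      with vertex≟ a b | vertex≟ c d
    ... | no _ | no _ = inj _ _ u≢w (suc-injective e) (x ∷ y ∷ [] , ux , wx)
    ... | yes refl | yes refl with adj-∷⁻ ux | adj-∷⁻ wx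
    ...   | inj₁ (refl , _)      | inj₁ (refl , _)      = u≢w refl
    ...   | inj₂ (a~x , a≡x , _) | _                    = adj-irrefl (∷-injectiveˡ a≡x) a~x
    ...   | _                    | inj₂ (c~x , c≡x , _) = adj-irrefl (∷-injectiveˡ c≡x) c~x

    extend-injective : IsInjectiveColoring (sierpinski G 2) f →
      ∀ m → IsInjectiveColoring (sierpinski G (2 + m)) extend
    extend-injective inj zero = extend-injective₂ inj
    extend-injective inj (suc m) (a ∷ us) (b ∷ ws) u≢w e (x ∷ xs , ux , wx)
      with adj-∷⁻ ux | adj-∷⁻ wx
    ... | inj₁ (refl , us~xs) | inj₁ (refl , ws~xs) =
          extend-injective inj m us ws (λ { refl → u≢w refl }) e (xs , us~xs , ws~xs)
    -- The linking edge makes `ws` and `xs` constant: `ws` has the new colour, while `us`, adjacent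
    -- to the constant `xs`, cannot.
    ... | inj₁ (_ , us~xs) | inj₂ (_ , refl , refl) =
          extend-adj-replicate us us~xs (trans e (extend-replicate m x))
    ... | inj₂ (_ , refl , refl) | inj₁ (_ , ws~xs) =
          extend-adj-replicate ws ws~xs (trans (sym e) (extend-replicate m x))
    -- Two linking edges at one vertex coincide: `xs` determines the first letter across the link,
    -- and both tails are constantly `x`.
    ... | inj₂ (_ , refl , xs≡a) | inj₂ (_ , refl , xs≡b) =
          u≢w (cong (_∷ _) (∷-injectiveˡ (trans (sym xs≡a) xs≡b)))

χᵢ-minimal : ∀ H {k} → InjectivelyColorable H k → χᵢ H ≤ k
χᵢ-minimal H c = let _ , min = χᵢ-isLeast H in min _ c

χᵢ-colorable : ∀ H → InjectivelyColorable H (χᵢ H)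
χᵢ-colorable H = let c , _ = χᵢ-isLeast H in c

mainTheorem1 : (G : FiniteSimpleGraph) (n : ℕ) → 2 ≤ n →
    χᵢ (sierpinski G 2) ≤ χᵢ (sierpinski G n) ×
    χᵢ (sierpinski G n) ≤ χᵢ (sierpinski G 2) + 1
mainTheorem1 G (suc (suc m)) (s≤s (s≤s z≤n)) = lower , upper
  where
  lower : χᵢ (sierpinski G 2) ≤ χᵢ (sierpinski G (2 + m))
  lower = χᵢ-minimal (sierpinski G 2) (colorable-restrict G m
    (subst (λ n → InjectivelyColorable (sierpinski G n) (χᵢ (sierpinski G (2 + m))))
           (+-comm 2 m) (χᵢ-colorable (sierpinski G (2 + m)))))

  upper : χᵢ (sierpinski G (2 + m)) ≤ χᵢ (sierpinski G 2) + 1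
  upper = let f , inj = χᵢ-colorable (sierpinski G 2) in
    subst (χᵢ (sierpinski G (2 + m)) ≤_) (+-comm 1 (χᵢ (sierpinski G 2)))
      (χᵢ-minimal (sierpinski G (2 + m)) (extend G f , extend-injective G f inj m))
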